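{- For interval selection with unit weights, for every instance, every arrival order, every fixed optimal solution used as reference, and every assignment of binary predictions with total error $\eta$ (measured with respect to that optimal solution), Algorithm Naive outputs a set of pairwise disjoint intervals of total weight $ALG \geq OPT - \eta$.
   Context: Interval selection: an instance is a finite nonempty set $\mathcal{I}$ of intervals $[s_i,f_i)$ on the real line, $s_i<f_i$, arriving one at a time in an arbitrary (adversarial) order. Two intervals conflict if they intersect. Each interval $I$ has a weight $w(I)$; unit weights means $w(I)=1$ for all $I$. The goal is to output a set of pairwise disjoint intervals of maximum total weight. $OPT$ denotes the maximum total weight of a set of pairwise disjoint intervals of the instance, and $ALG$ the total weight of the algorithm's final solution. Predictions: each interval $I$ arrives together with a bit $Prd(I)\in\{0,1\}$; $Prd(I)=1$ means $I$ is predicted to belong to a fixed optimal solution $O$, and $Prd(I)=0$ means it is predicted not to belong to $O$. The prediction of $I$ is accurate if ($Prd(I)=1 \iff I\in O$). Predictions may be arbitrary. Error (with respect to $O$, which may be any optimal solution): $\eta(I)=0$ if the prediction of $I$ is accurate; $\eta(I)=w(I)$ if $I\in O$ and $Prd(I)=0$; $\eta(I)=\sum_{J\in\mathcal{C}}w(J)-w(I)$ if $I\notin O$ and $Prd(I)=1$, where $\mathcal{C}$ is the set of intervals of $O$ that conflict with $I$. The total error is $\eta=\sum_{I\in\mathcal{I}}\eta(I)$. Algorithm Naive: start with an empty solution; on the arrival of $I$, accept $I$ (irrevocably) if and only if $Prd(I)=1$ and $I$ conflicts with no interval currently in the solution. -}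

module Defs where

open import Level using (Level; _⊔_)
open import Data.Bool using (Bool; true; false; if_then_else_)
open import Data.Bool.Properties using () renaming (_≟_ to _≟ᵇ_)
open import Data.Fin using (Fin)
open import Data.Fin.Properties using (any?)
open import Data.Fin.Subset using (Subset; _∈_; ⊥; ⁅_⁆; _∪_)
open import Data.Fin.Subset.Properties using (_∈?_)
open import Data.Integer using (ℤ; 0ℤ; 1ℤ; _-_; _≤_)
open import Data.Integer.Properties using (+-0-monoid)
open import Data.List using (List; foldl)
open import Data.Nat using (ℕ; NonZero)
open import Data.Product using (_×_; _,_; ∃-syntax)
open import Data.Sum using (inj₁; inj₂)
open import Data.Vec using (lookup; tabulate)
open import Relation.Binary.Bundles using (StrictTotalOrder)
open import Relation.Binary.PropositionalEquality using (_≡_; _≢_)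
open import Relation.Nullary using (¬_; Dec; does)
open import Relation.Nullary.Decidable using (map′; _×-dec_; ¬?)
import Algebra.Properties.Monoid.Sum as MonoidSum
import Relation.Binary.Properties.StrictTotalOrder as StrictTotalOrderProperties

open MonoidSum +-0-monoid using (sum)

-- Intervals, conflicts and the algorithm use only the order of the real line,
-- so the line is an arbitrary strict total order (trichotomy, hence
-- comparability of endpoints, is decidable by definition of the bundle).
module IntervalSelection {c ℓ₁ ℓ₂ : Level} (Line : StrictTotalOrder c ℓ₁ ℓ₂) where

  open StrictTotalOrder Line using (_≈_; _<_; _<?_) renaming (Carrier to Point)
  open StrictTotalOrderProperties Line
    using () renaming (_≤_ to _≤ₚ_; refl to ≤ₚ-refl; total to ≤ₚ-total)
  open import Relation.Binary.Construct.StrictToNonStrict _≈_ _<_ using (≤-<-trans)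

  private
    ≤<⇒< : ∀ {x y z} → x ≤ₚ y → y < z → x < z
    ≤<⇒< = ≤-<-trans (StrictTotalOrder.Eq.sym Line) (StrictTotalOrder.trans Line)
                     (StrictTotalOrder.<-respˡ-≈ Line)

  record Interval : Set (c ⊔ ℓ₂) where
    field
      start        : Point
      finish       : Point
      start<finish : start < finish

  open Interval public

  _∈ᴵ_ : Point → Interval → Set (ℓ₁ ⊔ ℓ₂)
  x ∈ᴵ I = start I ≤ₚ x × x < finish I

  Conflict : Interval → Interval → Set (c ⊔ ℓ₁ ⊔ ℓ₂)
  Conflict I J = ∃[ x ] x ∈ᴵ I × x ∈ᴵ J

  conflict? : ∀ I J → Dec (Conflict I J)
  conflict? I J = map′ to from (start I <? finish J ×-dec start J <? finish I)
    where
    to : start I < finish J × start J < finish I → Conflict I J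
    to (sI<fJ , sJ<fI) with ≤ₚ-total (start I) (start J)
    ... | inj₁ sI≤sJ = start J , (sI≤sJ , sJ<fI) , (≤ₚ-refl , start<finish J)
    ... | inj₂ sJ≤sI = start I , (≤ₚ-refl , start<finish I) , (sJ≤sI , sI<fJ)

    from : Conflict I J → start I < finish J × start J < finish I
    from (x , (sI≤x , x<fI) , (sJ≤x , x<fJ)) = ≤<⇒< sI≤x x<fJ , ≤<⇒< sJ≤x x<fI

  -- A finite nonempty set of intervals, enumerated without repetition.
  -- The enumeration is only a naming; arrival orders are separate.
  record Instance : Set (c ⊔ ℓ₁ ⊔ ℓ₂) where
    field
      size     : ℕ
      nonEmpty : NonZero size
      interval : Fin size → Interval
      distinct : ∀ i j → start (interval i) ≈ start (interval j) →
                 finish (interval i) ≈ finish (interval j) → i ≡ j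
      weight   : Fin size → ℤ

  UnitWeights : Instance → Set
  UnitWeights 𝓘 = ∀ i → Instance.weight 𝓘 i ≡ 1ℤ

  module _ (𝓘 : Instance) where

    open Instance 𝓘

    totalWeight : Subset size → ℤ
    totalWeight S = sum λ i → if lookup S i then weight i else 0ℤ

    PairwiseDisjoint : Subset size → Set (c ⊔ ℓ₁ ⊔ ℓ₂)
    PairwiseDisjoint S =
      ∀ i j → i ∈ S → j ∈ S → i ≢ j → ¬ Conflict (interval i) (interval j)

    IsOptimal : Subset size → Set (c ⊔ ℓ₁ ⊔ ℓ₂)
    IsOptimal O =
      PairwiseDisjoint O × (∀ S → PairwiseDisjoint S → totalWeight S ≤ totalWeight O)

    IsOPT : ℤ → Set (c ⊔ ℓ₁ ⊔ ℓ₂)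
    IsOPT opt =
      (∃[ S ] PairwiseDisjoint S × totalWeight S ≡ opt) ×
      (∀ S → PairwiseDisjoint S → totalWeight S ≤ opt)

    conflictsIn : Subset size → Fin size → Subset size
    conflictsIn O i =
      tabulate λ j → does (j ∈? O ×-dec conflict? (interval i) (interval j))

    -- Arguments of errorOf: whether i belongs to O, and the prediction for i.
    -- The error lives in ℤ because the last case can be negative for general weights.
    module _ (O : Subset size) (Prd : Fin size → Bool) where

      errorOf : Bool → Bool → Fin size → ℤ
      errorOf true  true  i = 0ℤ
      errorOf false false i = 0ℤ
      errorOf true  false i = weight i
      errorOf false true  i = totalWeight (conflictsIn O i) - weight i

      error : Fin size → ℤ
      error i = errorOf (lookup O i) (Prd i) i

      totalError : ℤ
      totalError = sum error

    module _ (Prd : Fin size → Bool) where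

      Accepts : Subset size → Fin size → Set (c ⊔ ℓ₁ ⊔ ℓ₂)
      Accepts S i =
        Prd i ≡ true × ¬ (∃[ j ] j ∈ S × Conflict (interval i) (interval j))

      accepts? : ∀ S i → Dec (Accepts S i)
      accepts? S i =
        (Prd i ≟ᵇ true) ×-dec
        ¬? (any? λ j → j ∈? S ×-dec conflict? (interval i) (interval j))

      naiveStep : Subset size → Fin size → Subset size
      naiveStep S i = if does (accepts? S i) then S ∪ ⁅ i ⁆ else S

      naive : List (Fin size) → Subset size
      naive = foldl naiveStep ⊥

{-# OPTIONS --safe #-}
-- Charge each interval J of O to the solution S of Naive or to the error: to
-- itself if J ∈ S or Prd J = 0, and otherwise to an interval I ∈ S that blocked
-- it. Such an I is outside O, and it receives at most |C(I)| = 1 + η(I) charges.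
-- An interval I ∉ S receives at most η(I): when I ∉ O and Prd I = 1 this needs
-- η(I) ≥ 0, i.e. C(I) ≠ ∅, which holds since otherwise O ∪ {I} would beat O.
module Submission where

open import Defs
open import Algebra.Properties.CommutativeMonoid.Sum as CommutativeMonoidSum using ()
open import Data.Bool using (Bool; true; false; if_then_else_; _∧_; _∨_; not)
open import Data.Fin using (Fin; zero; suc)
open import Data.Fin.Properties using (any?)
open import Data.Fin.Subset using (Subset; _∈_; _∉_; _⊆_; ⁅_⁆; _∪_; ⊥)
open import Data.Fin.Subset.Properties
  using (_∈?_; ∉⊥; x∈⁅x⁆; x∈⁅y⁆⇒x≡y; p⊆p∪q; q⊆p∪q; x∈p∪q⁻)
open import Data.Integer using (ℤ; 0ℤ; _+_; _-_; _≤_; _<_; +≤+; +<+)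
open import Data.Integer.Properties
open import Data.List using (List; []; _∷_; allFin; foldl)
import Data.List.Membership.Propositional as List
open import Data.List.Membership.Propositional.Properties using (∈-allFin)
open import Data.List.Relation.Binary.Permutation.Propositional using (_↭_; ↭-sym)
open import Data.List.Relation.Binary.Permutation.Propositional.Properties using (∈-resp-↭)
open import Data.List.Relation.Unary.Any using (here; there)
open import Data.Nat using (ℕ; z≤n; s≤s)
open import Data.Product using (_×_; _,_; proj₁; proj₂; ∃-syntax)
open import Data.Sum using (inj₁; inj₂)
open import Data.Vec using (lookup)
open import Data.Vec.Properties using (lookup∘tabulate; []=⇒lookup; lookup⇒[]=)
open import Function using (_∘_)
open import Level using (Level; _⊔_)
open import Relation.Binary.Bundles using (StrictTotalOrder)
open import Relation.Binary.PropositionalEquality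
open import Relation.Nullary using (¬_; Dec; yes; no; does; contradiction)
open import Relation.Nullary.Decidable using (_×-dec_; dec-true; decidable-stable)

open CommutativeMonoidSum +-0-commutativeMonoid
  using (sum; ∑-distrib-+; ∑-comm; sum-replicate-zero)

-- Finite sums of integers and double counting.

sum-mono-≤ : ∀ {n} {f g : Fin n → ℤ} → (∀ i → f i ≤ g i) → sum f ≤ sum g
sum-mono-≤ {ℕ.zero}  f≤g = ≤-refl
sum-mono-≤ {ℕ.suc n} f≤g = +-mono-≤ (f≤g zero) (sum-mono-≤ (f≤g ∘ suc))

sum-mono-< : ∀ {n} {f g : Fin n → ℤ} → (∀ i → f i ≤ g i) →
             ∀ i → f i < g i → sum f < sum g
sum-mono-< f≤g zero    f<g = +-mono-<-≤ f<g (sum-mono-≤ (f≤g ∘ suc))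
sum-mono-< f≤g (suc i) f<g = +-mono-≤-< (f≤g zero) (sum-mono-< (f≤g ∘ suc) i f<g)

sum-nonneg : ∀ {n} {f : Fin n → ℤ} → (∀ i → 0ℤ ≤ f i) → 0ℤ ≤ sum f
sum-nonneg {n} 0≤f = ≤-trans (≤-reflexive (sym (sum-replicate-zero n))) (sum-mono-≤ 0≤f)

sum-pos : ∀ {n} {f : Fin n → ℤ} → (∀ i → 0ℤ ≤ f i) → ∀ i → 0ℤ < f i → 0ℤ < sum f
sum-pos {n} 0≤f i 0<fi =
  ≤-<-trans (≤-reflexive (sym (sum-replicate-zero n))) (sum-mono-< 0≤f i 0<fi)

module _ {n : ℕ} where
  open ≤-Reasoning

  -- Double counting: `d i j` is what `j` charges to `i`, and `a` what each index charges to itself.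
  -- `∑-comm` turns the amounts sent into the amounts received.
  sum-charging : {f g a : Fin n → ℤ} (d : Fin n → Fin n → ℤ) →
                 (∀ j → f j ≤ a j + sum λ i → d i j) →
                 (∀ i → a i + sum (d i) ≤ g i) →
                 sum f ≤ sum g
  sum-charging {f} {g} {a} d f≤ ≤g = begin
    sum f                              ≤⟨ sum-mono-≤ f≤ ⟩
    sum (λ j → a j + sum λ i → d i j)  ≡⟨ ∑-distrib-+ a _ ⟩
    sum a + sum (λ j → sum λ i → d i j) ≡⟨ cong (sum a +_) (∑-comm d) ⟨
    sum a + sum (λ i → sum (d i))      ≡⟨ ∑-distrib-+ a _ ⟨
    sum (λ i → a i + sum (d i))        ≤⟨ sum-mono-≤ ≤g ⟩
    sum g                              ∎

0≤j⇒i≤i+j : ∀ {i j} → 0ℤ ≤ j → i ≤ i + j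
0≤j⇒i≤i+j {i} 0≤j = ≤-trans (≤-reflexive (sym (+-identityʳ i))) (+-monoʳ-≤ i 0≤j)

i+j-j≡i : ∀ i j → i + j - j ≡ i
i+j-j≡i i j = trans (+-assoc i j _) (trans (cong (i +_) (+-inverseʳ j)) (+-identityʳ i))

i-j+j≡i : ∀ i j → i - j + j ≡ i
i-j+j≡i i j = trans (+-assoc i _ j) (trans (cong (i +_) (+-inverseˡ j)) (+-identityʳ i))

-- `naiveStep` branches on a bare boolean; this gives each branch back the evidence behind the
-- decision.
if-does-elim : ∀ {a b p} {A : Set a} {B : Set b} (P : B → Set p) {x y : B} (a? : Dec A) →
               (A → P x) → (¬ A → P y) → P (if does a? then x else y)
if-does-elim P (yes a) px py = px a
if-does-elim P (no ¬a) px py = py ¬a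

∉⇒lookup≡false : ∀ {n} {S : Subset n} {i} → i ∉ S → lookup S i ≡ false
∉⇒lookup≡false {S = S} {i} i∉S with lookup S i in eq
... | true  = contradiction (lookup⇒[]= i S eq) i∉S
... | false = refl

lookup≡false⇒∉ : ∀ {n} {S : Subset n} {i} → lookup S i ≡ false → i ∉ S
lookup≡false⇒∉ eq i∈S with () ← trans (sym eq) ([]=⇒lookup i∈S)

-- Conflicts and blocking.

module _ {c ℓ₁ ℓ₂ : Level} {Line : StrictTotalOrder c ℓ₁ ℓ₂} where

  open IntervalSelection Line
  open import Relation.Binary.Properties.StrictTotalOrder Line
    using () renaming (refl to ≤ₚ-refl)

  Conflict-refl : ∀ I → Conflict I I
  Conflict-refl I = start I , (≤ₚ-refl , start<finish I) , (≤ₚ-refl , start<finish I)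

  Conflict-sym : ∀ I J → Conflict I J → Conflict J I
  Conflict-sym _ _ (x , x∈I , x∈J) = x , x∈J , x∈I

  module _ (𝓘 : Instance) where

    open Instance 𝓘

    Blocked : Subset size → Fin size → Set (c ⊔ ℓ₁ ⊔ ℓ₂)
    Blocked S i = ∃[ j ] j ∈ S × Conflict (interval i) (interval j)

    blocked? : ∀ S i → Dec (Blocked S i)
    blocked? S i = any? λ j → j ∈? S ×-dec conflict? (interval i) (interval j)

    Blocked-mono : ∀ {S T i} → S ⊆ T → Blocked S i → Blocked T i
    Blocked-mono S⊆T (j , j∈S , i⋈j) = j , S⊆T j∈S , i⋈j

    -- Serves twice: for the acceptance step of the algorithm, and for enlarging an optimal solution
    -- in `optimal-blocks`.
    disjoint-insert : ∀ {S i} → PairwiseDisjoint 𝓘 S → ¬ Blocked S i →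
                      PairwiseDisjoint 𝓘 (S ∪ ⁅ i ⁆)
    disjoint-insert {S} {i} disj free j k j∈ k∈ j≢k j⋈k
      with x∈p∪q⁻ S ⁅ i ⁆ j∈ | x∈p∪q⁻ S ⁅ i ⁆ k∈
    ... | inj₁ j∈S | inj₁ k∈S = disj j k j∈S k∈S j≢k j⋈k
    ... | inj₂ j∈i | inj₂ k∈i = j≢k (trans (x∈⁅y⁆⇒x≡y i j∈i) (sym (x∈⁅y⁆⇒x≡y i k∈i)))
    ... | inj₁ j∈S | inj₂ k∈i with refl ← x∈⁅y⁆⇒x≡y i k∈i =
      free (j , j∈S , Conflict-sym (interval j) (interval i) j⋈k)
    ... | inj₂ j∈i | inj₁ k∈S with refl ← x∈⁅y⁆⇒x≡y i j∈i = free (k , k∈S , j⋈k)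

    ∈-conflictsIn : ∀ {O i j} → j ∈ O → Conflict (interval i) (interval j) →
                    lookup (conflictsIn 𝓘 O i) j ≡ true
    ∈-conflictsIn {O} {i} {j} j∈O i⋈j =
      trans (lookup∘tabulate _ j)
            (dec-true (j ∈? O ×-dec conflict? (interval i) (interval j)) (j∈O , i⋈j))

    -- Invariants of Naive.

    module _ (Prd : Fin size → Bool) where

      -- The starting solution is arbitrary because induction over the arrivals changes the
      -- accumulator of the fold.
      naiveFrom : Subset size → List (Fin size) → Subset size
      naiveFrom = foldl (naiveStep 𝓘 Prd)

      module _ {p : Level} (P : Subset size → Set p)
               (insert : ∀ {S i} → Accepts 𝓘 Prd S i → P S → P (S ∪ ⁅ i ⁆)) where

        naiveStep-preserves : ∀ {S} i → P S → P (naiveStep 𝓘 Prd S i)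
        naiveStep-preserves {S} i PS =
          if-does-elim P (accepts? 𝓘 Prd S i) (λ acc → insert acc PS) (λ _ → PS)

        naiveFrom-preserves : ∀ {S} is → P S → P (naiveFrom S is)
        naiveFrom-preserves []       PS = PS
        naiveFrom-preserves (i ∷ is) PS =
          naiveFrom-preserves is (naiveStep-preserves i PS)

      naive-disjoint : ∀ is → PairwiseDisjoint 𝓘 (naive 𝓘 Prd is)
      naive-disjoint is =
        naiveFrom-preserves (PairwiseDisjoint 𝓘)
          (λ (_ , free) disj → disjoint-insert disj free)
          is (λ _ _ i∈⊥ → contradiction i∈⊥ ∉⊥)

      naive-predicted : ∀ is {j} → j ∈ naive 𝓘 Prd is → Prd j ≡ true
      naive-predicted is =
        naiveFrom-preserves (λ S → ∀ {j} → j ∈ S → Prd j ≡ true) insert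
          is (λ j∈⊥ → contradiction j∈⊥ ∉⊥)
        where
        insert : ∀ {S i} → Accepts 𝓘 Prd S i → (∀ {j} → j ∈ S → Prd j ≡ true) →
                 ∀ {j} → j ∈ S ∪ ⁅ i ⁆ → Prd j ≡ true
        insert {S} {i} (prd , _) pred j∈ with x∈p∪q⁻ S ⁅ i ⁆ j∈
        ... | inj₁ j∈S = pred j∈S
        ... | inj₂ j∈i with refl ← x∈⁅y⁆⇒x≡y i j∈i = prd

      -- An accepted interval blocks itself, since `Conflict` is reflexive. A predicted interval can
      -- be rejected only because of a conflict.
      naiveStep-blocks : ∀ S i → Prd i ≡ true → Blocked (naiveStep 𝓘 Prd S i) i
      naiveStep-blocks S i prd = if-does-elim (λ T → Blocked T i) (accepts? 𝓘 Prd S i)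
        (λ _ → i , q⊆p∪q S ⁅ i ⁆ (x∈⁅x⁆ i) , Conflict-refl (interval i))
        (λ ¬acc → decidable-stable (blocked? S i) λ free → ¬acc (prd , free))

      -- Blocking is established when `i` arrives and persists because the solution only grows.
      naiveFrom-blocks : ∀ S {is i} → Prd i ≡ true → i List.∈ is → Blocked (naiveFrom S is) i
      naiveFrom-blocks S {i = i} prd (here {xs = is} refl) =
        naiveFrom-preserves (λ T → Blocked T i)
          (λ {T} {j} _ → Blocked-mono (p⊆p∪q ⁅ j ⁆))
          is (naiveStep-blocks S i prd)
      naiveFrom-blocks S prd (there i∈is) = naiveFrom-blocks _ prd i∈is

    -- Unit weights and optimality.

    module _ (unit : UnitWeights 𝓘) where

      weighted : Bool → Fin size → ℤ
      weighted b i = if b then weight i else 0ℤ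

      0<weight : ∀ i → 0ℤ < weight i
      0<weight i rewrite unit i = +<+ (s≤s z≤n)

      0≤weighted : ∀ b i → 0ℤ ≤ weighted b i
      0≤weighted true  i = <⇒≤ (0<weight i)
      0≤weighted false i = ≤-refl

      -- Integrality: a positive integer is at least one, so a single conflict or charge already
      -- pays for a whole interval.
      0<⇒weight≤ : ∀ i {k} → 0ℤ < k → weight i ≤ k
      0<⇒weight≤ i 0<k rewrite unit i = i<j⇒suc[i]≤j 0<k

      totalWeight-insert : ∀ {S i} → i ∉ S → totalWeight 𝓘 S < totalWeight 𝓘 (S ∪ ⁅ i ⁆)
      totalWeight-insert {S} {i} i∉S = sum-mono-< grow i strict
        where
        grow : ∀ j → weighted (lookup S j) j ≤ weighted (lookup (S ∪ ⁅ i ⁆) j) j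
        grow j with lookup S j in eq
        ... | false = 0≤weighted (lookup (S ∪ ⁅ i ⁆) j) j
        ... | true rewrite []=⇒lookup (p⊆p∪q ⁅ i ⁆ (lookup⇒[]= j S eq)) = ≤-refl

        strict : weighted (lookup S i) i < weighted (lookup (S ∪ ⁅ i ⁆) i) i
        strict rewrite ∉⇒lookup≡false i∉S | []=⇒lookup (q⊆p∪q S ⁅ i ⁆ (x∈⁅x⁆ i)) = 0<weight i

      optimal-blocks : ∀ {O i} → IsOptimal 𝓘 O → i ∉ O → Blocked O i
      optimal-blocks {O} {i} (disj , max) i∉O = decidable-stable (blocked? O i) λ free →
        <⇒≱ (totalWeight-insert i∉O) (max (O ∪ ⁅ i ⁆) (disjoint-insert disj free))

      -- Makes the error of a false positive nonnegative: by maximality of `O` some member conflicts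
      -- with `i`, and that one conflict weighs enough.
      weight≤conflicts : ∀ {O i} → IsOptimal 𝓘 O → i ∉ O →
                         weight i ≤ totalWeight 𝓘 (conflictsIn 𝓘 O i)
      weight≤conflicts {O} {i} opt i∉O with optimal-blocks opt i∉O
      ... | j , j∈O , i⋈j =
        0<⇒weight≤ i (sum-pos (λ k → 0≤weighted (lookup (conflictsIn 𝓘 O i) k) k) j 0<j)
        where
        0<j : 0ℤ < weighted (lookup (conflictsIn 𝓘 O i) j) j
        0<j rewrite ∈-conflictsIn j∈O i⋈j = 0<weight j

      -- The charging argument, for any `S` of predicted intervals that blocks every predicted
      -- interval.

      module _ (Prd : Fin size → Bool) {O S : Subset size} (opt : IsOptimal 𝓘 O)
               (predicted : ∀ {i} → i ∈ S → Prd i ≡ true)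
               (blocks : ∀ {i} → Prd i ≡ true → Blocked S i) where

        private
          selfCharge : Fin size → ℤ
          selfCharge i = weighted (lookup O i ∧ (lookup S i ∨ not (Prd i))) i

          -- The charge goes from `j` to `i`. Here `j` charges every conflicting `i` in `S` outside
          -- `O`, not one chosen blocker, and does so even if it has a self charge. The overcount is
          -- harmless: the total received by such an `i` is exactly the weight of
          -- `conflictsIn 𝓘 O i`, for which its weight and error together provide.
          charge : Fin size → Fin size → ℤ
          charge i j = if lookup S i ∧ not (lookup O i)
                       then weighted (lookup (conflictsIn 𝓘 O i) j) j else 0ℤ

          0≤charge : ∀ i j → 0ℤ ≤ charge i j
          0≤charge i j with lookup S i ∧ not (lookup O i)
          ... | true  = 0≤weighted (lookup (conflictsIn 𝓘 O i) j) j
          ... | false = ≤-refl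

          0≤charged : ∀ j → 0ℤ ≤ sum λ i → charge i j
          0≤charged j = sum-nonneg λ i → 0≤charge i j

          rejected-charged : ∀ {j} → j ∈ O → j ∉ S → Prd j ≡ true →
                             weight j ≤ sum λ i → charge i j
          rejected-charged {j} j∈O j∉S prd with blocks prd
          ... | i , i∈S , j⋈i = 0<⇒weight≤ j (sum-pos (λ i → 0≤charge i j) i 0<ij)
            where
            i∉O : i ∉ O
            -- The blocker lies in `S` and `j` does not, so they differ; two distinct members of `O`
            -- cannot conflict.
            i∉O i∈O = proj₁ opt j i j∈O i∈O (λ j≡i → j∉S (subst (_∈ S) (sym j≡i) i∈S)) j⋈i

            0<ij : 0ℤ < charge i j
            0<ij rewrite []=⇒lookup i∈S | ∉⇒lookup≡false i∉O
                       | ∈-conflictsIn j∈O (Conflict-sym (interval j) (interval i) j⋈i) = 0<weight j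

          covered : ∀ j → weighted (lookup O j) j ≤ selfCharge j + sum λ i → charge i j
          covered j with lookup O j in j?O | lookup S j in j?S | Prd j in prd
          ... | false | _     | _     = +-monoʳ-≤ 0ℤ (0≤charged j)
          ... | true  | true  | _     = 0≤j⇒i≤i+j (0≤charged j)
          ... | true  | false | false = 0≤j⇒i≤i+j (0≤charged j)
          -- The only members of `O` without a self charge: their blockers must pay.
          ... | true  | false | true  = subst (weight j ≤_) (sym (+-identityˡ _))
            (rejected-charged (lookup⇒[]= j O j?O) (lookup≡false⇒∉ j?S) prd)

          uncharged : sum {size} (λ _ → 0ℤ) ≡ 0ℤ
          uncharged = sum-replicate-zero size

          -- Equality holds in every possible case except a false positive outside `S`, where the
          -- slack is its error.
          paid : ∀ i → selfCharge i + sum (charge i) ≤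
                       weighted (lookup S i) i + error 𝓘 O Prd i
          paid i with lookup O i in i?O | lookup S i in i?S | Prd i in prd
          ... | _     | true  | false
            with () ← trans (sym prd) (predicted (lookup⇒[]= i S i?S))
          ... | true  | true  | true  = ≤-reflexive (cong (weight i +_) uncharged)
          ... | true  | false | true  = ≤-reflexive (cong (0ℤ +_) uncharged)
          ... | true  | false | false =
            ≤-reflexive (trans (cong (weight i +_) uncharged) (+-comm (weight i) 0ℤ))
          ... | false | false | false = ≤-reflexive (cong (0ℤ +_) uncharged)
          -- Nothing is charged to a rejected false positive, so it suffices that its error is
          -- nonnegative; optimality of `O` enters here.
          ... | false | false | true  = +-monoʳ-≤ 0ℤ
            (≤-trans (≤-reflexive uncharged)
              (i≤j⇒0≤j-i (weight≤conflicts opt (lookup≡false⇒∉ i?O))))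
          -- For an accepted false positive the weight cancels the subtracted term of its error,
          -- leaving the received charges `C`.
          ... | false | true  | true  = ≤-reflexive
            (trans (+-identityˡ C)
              (sym (trans (+-comm (weight i) (C - weight i)) (i-j+j≡i C (weight i)))))
            where C = totalWeight 𝓘 (conflictsIn 𝓘 O i)

        totalWeight≤totalWeight+totalError :
          totalWeight 𝓘 O ≤ totalWeight 𝓘 S + totalError 𝓘 O Prd
        totalWeight≤totalWeight+totalError =
          subst (totalWeight 𝓘 O ≤_) (∑-distrib-+ (λ i → weighted (lookup S i) i) (error 𝓘 O Prd))
            (sum-charging {a = selfCharge} charge covered paid)

theorem3p1 : ∀ {c ℓ₁ ℓ₂} (Line : StrictTotalOrder c ℓ₁ ℓ₂) →
    let open IntervalSelection Line in
    (𝓘 : Instance) → UnitWeights 𝓘 →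
    let open Instance 𝓘 in
    (arrivals : List (Fin size)) → arrivals ↭ allFin size →
    (O : Subset size) → IsOptimal 𝓘 O →
    (Prd : Fin size → Bool) →
    (opt : ℤ) → IsOPT 𝓘 opt →
    PairwiseDisjoint 𝓘 (naive 𝓘 Prd arrivals) ×
    opt - totalError 𝓘 O Prd ≤ totalWeight 𝓘 (naive 𝓘 Prd arrivals)
theorem3p1 Line 𝓘 unit arrivals perm O optO Prd opt ((S , disjS , refl) , _) =
  naive-disjoint 𝓘 Prd arrivals , (begin
    -- `opt` is attained by some disjoint `S`, possibly different from the reference `O`; optimality
    -- of `O` bridges the two.
    totalWeight 𝓘 S - η  ≤⟨ +-monoˡ-≤ _ (proj₂ optO S disjS) ⟩
    totalWeight 𝓘 O - η  ≤⟨ +-monoˡ-≤ _ (totalWeight≤totalWeight+totalError 𝓘 unit Prd optO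
                              (naive-predicted 𝓘 Prd arrivals)
                              -- The arrivals are a permutation of all indices, so every predicted
                              -- interval does arrive and ends up blocked.
                              (λ {i} prd → naiveFrom-blocks 𝓘 Prd ⊥ prd
                                             (∈-resp-↭ (↭-sym perm) (∈-allFin i)))) ⟩
    alg + η - η          ≡⟨ i+j-j≡i alg η ⟩
    alg                  ∎)
  where
  open IntervalSelection Line
  open ≤-Reasoning
  η   = totalError 𝓘 O Prd
  alg = totalWeight 𝓘 (naive 𝓘 Prd arrivals)
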